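{- For every integer $n\ge 2$ there is a smallest integer $m(n)$ such that every $S$-vector on $n$ terminals can be realized in $K_{m(n)}$, and $$m(n)\le M(n),$$ where $M(n)$ is the number of pairwise intersecting antichains of non-empty subsets of $[n]$.
   Context: For a positive integer $k$ let $[k]=\{1,\dots,k\}$. $K_N$ is the undirected complete graph on vertex set $[N]$, with edge set $E_N=\{(i,j):1\le i<j\le N\}$. A weight map is a function $w:E_N\to\mathbb{R}_{\ge 0}$. For $W\subseteq[N]$, the cut $C(W)$ is the set of edges with exactly one endpoint in $W$, and $\|C(W)\|$ is the sum of the weights of its edges. For integers $1\le n<N$, the vertices in $[n]$ of $K_N$ are called terminals, vertex $N$ is the sink. Given $w$ on $K_N$, for each $\varnothing\ne I\subseteq[n]$ set $$S_I=\min\{\|C(W)\| : W\subseteq[N-1],\ W\cap[n]=I\}.$$ The resulting vector $S=(S_I)_{\varnothing\ne I\subseteq[n]}\in\mathbb{R}^{2^n-1}$ is said to be realized by $w$ in $K_N$. An $S$-vector on $n$ terminals is a vector realized by some weight map $w$ in $K_N$ for some $N>n$. A family of subsets of $[n]$ is an antichain if no member is contained in another; it is pairwise intersecting if any two of its members have non-empty intersection. The empty family and families consisting of a single (non-empty) subset are considered pairwise intersecting antichains and are counted in $M(n)$. (Thus $M(1)=2$, $M(2)=4$, $M(3)=12$, $M(4)=81$.) -}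

module Defs where

open import Data.Fin using (Fin; toℕ; inject≤) renaming (_<_ to _<ᶠ_)
open import Data.Fin.Properties using () renaming (_<?_ to _<ᶠ?_)
open import Data.Fin.Subset using (Subset; inside; outside; _∈_; _∉_; _⊆_; _∩_; Nonempty)
open import Data.Fin.Subset.Properties using (_∈?_; _⊆?_; nonempty?)
open import Data.Bool.Properties using () renaming (_≟_ to _≟ᵇ_)
open import Data.List using (List; []; _∷_; _++_; map; filter; foldr; length; concatMap; mapMaybe; allFin)
open import Data.List.Relation.Unary.All using (All; all?)
import Data.Maybe as Maybe
open import Data.Nat using (ℕ; suc; _≤_; _<_; _≥_; _⊔_)
import Data.Nat.Properties as ℕₚ
open import Data.Product using (Σ; ∃; ∃₂; _×_; _,_)
open import Data.Rational as ℚ using (ℚ; 0ℚ; ½)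
import Data.Rational.Properties as ℚₚ
open import Data.Rational.Solver using (module +-*-Solver)
open import Data.Sum using (_⊎_)
open import Data.Vec using ([]; _∷_)
open import Data.Vec.Properties using (≡-dec)
open import Function.Bundles using (_⇔_)
open import Relation.Binary.PropositionalEquality using (_≡_; refl; cong; subst)
open import Relation.Nullary using (Dec; ¬?; _×-dec_; _⊎-dec_; _→-dec_)
open import Relation.Nullary.Decidable using (dec⇒maybe)

-- The reals as Cauchy sequences of rationals, taken up to _≈_.
-- Weights are only ever added and compared, so no product is defined.

record ℝ : Set where
  constructor mkℝ
  field
    seq    : ℕ → ℚ
    cauchy : ∀ ε → 0ℚ ℚ.< ε →
             ∃ λ K → ∀ i j → i ≥ K → j ≥ K → ℚ.∣ seq i ℚ.- seq j ∣ ℚ.< ε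

open ℝ public

infix 4 _≈_ _≤ℝ_
infixl 6 _+ℝ_

_≈_ : ℝ → ℝ → Set
x ≈ y = ∀ ε → 0ℚ ℚ.< ε → ∃ λ K → ∀ i → i ≥ K → ℚ.∣ seq x i ℚ.- seq y i ∣ ℚ.< ε

_≤ℝ_ : ℝ → ℝ → Set
x ≤ℝ y = ∀ ε → 0ℚ ℚ.< ε → ∃ λ K → ∀ i → i ≥ K → seq x i ℚ.< seq y i ℚ.+ ε

0ℝ : ℝ
0ℝ = mkℝ (λ _ → 0ℚ) (λ ε ε>0 → 0 , λ _ _ _ _ → ε>0)

private
  half>0 : ∀ ε → 0ℚ ℚ.< ε → 0ℚ ℚ.< ½ ℚ.* ε
  half>0 ε ε>0 = subst (ℚ._< ½ ℚ.* ε) (ℚₚ.*-zeroʳ ½) (ℚₚ.*-monoʳ-<-pos ½ ε>0)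

  halves : ∀ ε → ½ ℚ.* ε ℚ.+ ½ ℚ.* ε ≡ ε
  halves = solve 1 (λ e → con ½ :* e :+ con ½ :* e := e) refl
    where open +-*-Solver

  rearrange : ∀ a b c d → (a ℚ.+ b) ℚ.- (c ℚ.+ d) ≡ (a ℚ.- c) ℚ.+ (b ℚ.- d)
  rearrange = solve 4 (λ a b c d → (a :+ b) :- (c :+ d) := (a :- c) :+ (b :- d)) refl
    where open +-*-Solver

_+ℝ_ : ℝ → ℝ → ℝ
x +ℝ y = mkℝ (λ i → seq x i ℚ.+ seq y i) sum-cauchy
  where
  sum-cauchy : ∀ ε → 0ℚ ℚ.< ε → ∃ λ K → ∀ i j → i ≥ K → j ≥ K →
               ℚ.∣ (seq x i ℚ.+ seq y i) ℚ.- (seq x j ℚ.+ seq y j) ∣ ℚ.< ε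
  sum-cauchy ε ε>0 with cauchy x (½ ℚ.* ε) (half>0 ε ε>0) | cauchy y (½ ℚ.* ε) (half>0 ε ε>0)
  ... | K , p | L , q = K ⊔ L , λ i j i≥ j≥ → begin-strict
      ℚ.∣ (seq x i ℚ.+ seq y i) ℚ.- (seq x j ℚ.+ seq y j) ∣
        ≡⟨ cong ℚ.∣_∣ (rearrange (seq x i) (seq y i) (seq x j) (seq y j)) ⟩
      ℚ.∣ (seq x i ℚ.- seq x j) ℚ.+ (seq y i ℚ.- seq y j) ∣
        ≤⟨ ℚₚ.∣p+q∣≤∣p∣+∣q∣ (seq x i ℚ.- seq x j) (seq y i ℚ.- seq y j) ⟩
      ℚ.∣ seq x i ℚ.- seq x j ∣ ℚ.+ ℚ.∣ seq y i ℚ.- seq y j ∣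
        <⟨ ℚₚ.+-mono-< (p i j (ℕₚ.m⊔n≤o⇒m≤o K L i≥) (ℕₚ.m⊔n≤o⇒m≤o K L j≥))
                       (q i j (ℕₚ.m⊔n≤o⇒n≤o K L i≥) (ℕₚ.m⊔n≤o⇒n≤o K L j≥)) ⟩
      ½ ℚ.* ε ℚ.+ ½ ℚ.* ε
        ≡⟨ halves ε ⟩
      ε ∎
    where open ℚₚ.≤-Reasoning

sumℝ : List ℝ → ℝ
sumℝ = foldr _+ℝ_ 0ℝ

-- The vertex v of [N] is the element of Fin N with toℕ equal to v - 1.

Edge : ℕ → Set
Edge N = ∃₂ λ (i j : Fin N) → i <ᶠ j

edges : ∀ N → List (Edge N)
edges N = concatMap (λ i → mapMaybe (edge? i) (allFin N)) (allFin N)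
  where
  edge? : (i j : Fin N) → Maybe.Maybe (Edge N)
  edge? i j = Maybe.map (λ i<j → i , j , i<j) (dec⇒maybe (i <ᶠ? j))

record WeightMap (N : ℕ) : Set where
  field
    weight : Edge N → ℝ
    nonneg : ∀ e → 0ℝ ≤ℝ weight e

open WeightMap public

Crosses : ∀ {N} → Subset N → Edge N → Set
Crosses W (i , j , _) = (i ∈ W × j ∉ W) ⊎ (i ∉ W × j ∈ W)

crosses? : ∀ {N} (W : Subset N) (e : Edge N) → Dec (Crosses W e)
crosses? W (i , j , _) =
  ((i ∈? W) ×-dec ¬? (j ∈? W)) ⊎-dec (¬? (i ∈? W) ×-dec (j ∈? W))

cut : ∀ {N} → Subset N → List (Edge N)
cut W = filter (crosses? W) (edges _)

∥cut∥ : ∀ {N} → WeightMap N → Subset N → ℝ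
∥cut∥ w W = sumℝ (map (weight w) (cut W))

IsSink : ∀ {N} → Fin N → Set
IsSink {N} v = suc (toℕ v) ≡ N

terminal : ∀ {n N} → n < N → Fin n → Fin N
terminal n<N i = inject≤ i (ℕₚ.<⇒≤ n<N)

-- W ⊆ [N-1] and W ∩ [n] = I
Separates : ∀ {n N} → n < N → Subset n → Subset N → Set
Separates n<N I W = (∀ v → IsSink v → v ∉ W) × (∀ i → terminal n<N i ∈ W ⇔ i ∈ I)

-- x = min { f a : P a }
IsMin : {A : Set} → (A → Set) → (A → ℝ) → ℝ → Set
IsMin P f x = (∃ λ a → P a × f a ≈ x) × (∀ a → P a → x ≤ℝ f a)

-- Irrelevance makes the coordinate depend on I alone, not on the element
-- of I chosen to witness that it is nonempty.
Vector : ℕ → Set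
Vector n = (I : Subset n) → .(Nonempty I) → ℝ

Realizes : ∀ {n N} → n < N → WeightMap N → Vector n → Set
Realizes n<N w S = ∀ I .(I≠∅ : Nonempty I) → IsMin (Separates n<N I) (∥cut∥ w) (S I I≠∅)

RealizedIn : ∀ n → ℕ → Vector n → Set
RealizedIn n N S = Σ (n < N) λ n<N → ∃ λ (w : WeightMap N) → Realizes n<N w S

SVector : ∀ n → Vector n → Set
SVector n S = ∃ λ N → RealizedIn n N S

-- This forces n < N: zero weights on K_{n+1} realize the zero vector.
AllRealizedIn : ℕ → ℕ → Set
AllRealizedIn n N = ∀ S → SVector n S → RealizedIn n N S

Least : (ℕ → Set) → ℕ → Set
Least P m = P m × (∀ k → P k → m ≤ k)

subsets : ∀ n → List (Subset n)
subsets 0       = [] ∷ []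
subsets (suc n) = map (outside ∷_) (subsets n) ++ map (inside ∷_) (subsets n)

sublists : {A : Set} → List A → List (List A)
sublists []       = [] ∷ []
sublists (x ∷ xs) = sublists xs ++ map (x ∷_) (sublists xs)

-- As subsets n lists each subset of [n] once, every family of nonempty
-- subsets of [n] occurs exactly once here.
families : ∀ n → List (List (Subset n))
families n = sublists (filter nonempty? (subsets n))

Antichain : ∀ {n} → List (Subset n) → Set
Antichain F = All (λ A → All (λ B → A ⊆ B → A ≡ B) F) F

PairwiseIntersecting : ∀ {n} → List (Subset n) → Set
PairwiseIntersecting F = All (λ A → All (λ B → Nonempty (A ∩ B)) F) F

antichain? : ∀ {n} (F : List (Subset n)) → Dec (Antichain F)
antichain? F = all? (λ A → all? (λ B → (A ⊆? B) →-dec ≡-dec _≟ᵇ_ A B) F) F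

pairwiseIntersecting? : ∀ {n} (F : List (Subset n)) → Dec (PairwiseIntersecting F)
pairwiseIntersecting? F = all? (λ A → all? (λ B → nonempty? (A ∩ B)) F) F

M : ℕ → ℕ
M n = length (filter (λ F → antichain? F ×-dec pairwiseIntersecting? F) (families n))

_ : M 1 ≡ 2
_ = refl

_ : M 2 ≡ 4
_ = refl

_ : M 3 ≡ 12
_ = refl

{-# OPTIONS --safe #-}

-- For each nonempty I choose an inclusion-minimal minimum cut W_I. Uncrossing
-- W_I and W_J by submodularity gives W_I ⊆ W_J whenever I ⊆ J, and by
-- posimodularity W_I ∩ W_J = ∅ whenever I ∩ J = ∅. Hence the signature
-- {I : v ∈ W_I} of a vertex v is an up-set of pairwise intersecting sets, and
-- its minimal members form an intersecting antichain that determines it.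
-- Merging vertices with equal signatures keeps every W_I a cut and creates no
-- new cuts, so M(n) vertices suffice. The terminals and the sink have distinct
-- signatures ({I : i ∈ I}, and ∅ for the sink), so after a permutation of the
-- merged vertices they occupy their prescribed places. The least m(n) then
-- exists by well-foundedness of ℕ.

module Submission where

open import Defs
open import Algebra.Bundles using (CommutativeMonoid)
open import Axiom.ExcludedMiddle using (ExcludedMiddle)
open import Data.Bool using (Bool; true; false; not; _∧_; _∨_; _xor_; if_then_else_)
open import Data.Bool.Properties using (⇔→≡)
open import Data.Fin using (Fin; zero; suc; toℕ; fromℕ)
open import Data.Fin.Permutation using (Permutation′; _⟨$⟩ʳ_; _∘ₚ_; transpose)
import Data.Fin.Permutation as Perm
open import Data.Fin.Properties
  using (<-cmp; any?; suc-injective; injective⇒≤; toℕ-fromℕ; toℕ-inject≤; toℕ<n; toℕ-injective; inject≤-injective)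
  renaming (_<?_ to _<ᶠ?_; _≟_ to _≟ᶠ_)
open import Data.Fin.Subset using (Subset; inside; outside; _∈_; _∉_; _⊆_; _⊂_; _∩_; Nonempty; ⁅_⁆)
open import Data.Fin.Subset.Induction using (⊂-wellFounded)
open import Data.Fin.Subset.Properties
  using (_∈?_; nonempty?; ⊆-antisym; ⊆-trans; x∈⁅x⁆; x∈⁅y⁆⇒x≡y; x∈p∩q⁺)
open import Data.List using (List; []; _∷_; _++_; map; filter; foldr; concatMap; mapMaybe; allFin)
  renaming (tabulate to tabulateᴸ; lookup to lookupᴸ)
open import Data.List.Membership.Propositional using () renaming (_∈_ to _∈ᴸ_)
open import Data.List.Membership.Propositional.Properties using (∈-++⁺ˡ; ∈-++⁺ʳ; ∈-map⁺; ∈-filter⁺; ∈-filter⁻)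
open import Data.List.Properties using (map-tabulate)
import Data.List.Relation.Unary.All as All
import Data.List.Relation.Unary.Any as Any
open import Data.List.Relation.Unary.Any.Properties using (lookup-index)
open import Data.Maybe as Maybe using (Maybe; just; nothing; maybe′)
open import Data.Nat as ℕ using (ℕ; zero; suc; z≤n; s≤s; _≤_; _<_)
open import Data.Nat.Induction using (<-wellFounded)
import Data.Nat.Properties as ℕₚ
open import Data.Product using (Σ; ∃; _×_; _,_; proj₁; proj₂)
open import Data.Rational as ℚ using (ℚ; 0ℚ; ½)
import Data.Rational.Properties as ℚₚ
open import Data.Rational.Solver using (module +-*-Solver)
open import Data.Sum using (inj₁; inj₂)
open import Data.Vec using ([]; _∷_; lookup; tabulate; zipWith)
open import Data.Vec.Properties
  using ([]=⇒lookup; lookup⇒[]=; lookup∘tabulate; tabulate∘lookup; tabulate-cong; lookup-zipWith)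
open import Function using (_∘_; id; _⇔_; mk⇔; Injective; Equivalence; Injection)
open import Function.Properties.Inverse using (↔⇒↣)
open import Induction.WellFounded using (WellFounded; Acc; acc)
open import Level using (0ℓ)
open import Relation.Binary using (Rel; Preorder; IsPreorder; _Preserves₂_⟶_⟶_; tri<; tri≈; tri>)
import Relation.Binary.Reasoning.Preorder as ≼-Reasoning
import Relation.Binary.Reasoning.Setoid as ≋-Reasoning
open import Relation.Binary.PropositionalEquality
  using (_≡_; _≢_; refl; sym; trans; cong; cong₂; subst; subst₂; module ≡-Reasoning)
open import Relation.Nullary using (Dec; yes; no; does; ¬_; contradiction)
open import Relation.Nullary.Decidable
  using (dec⇒maybe; dec-true; dec-false; recompute; does-⇔; from-yes; map′; _×-dec_; decidable-stable)

-- Cut indicators and their modular inequalities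

# : Bool → ℕ
# b = if b then 1 else 0

does-∈? : ∀ {N} (v : Fin N) (W : Subset N) → does (v ∈? W) ≡ lookup W v
does-∈? v W with lookup W v in eq
... | true  = dec-true (v ∈? W) (lookup⇒[]= v W eq)
... | false = dec-false (v ∈? W) λ v∈W → contradiction (trans (sym eq) ([]=⇒lookup v∈W)) λ ()

separated : ∀ {N} → Subset N → Edge N → Bool
separated W (i , j , _) = lookup W i xor lookup W j

does-crosses? : ∀ {N} (W : Subset N) (e : Edge N) → does (crosses? W e) ≡ separated W e
does-crosses? W (i , j , _) rewrite does-∈? i W | does-∈? j W with lookup W i | lookup W j
... | true  | true  = refl
... | true  | false = refl
... | false | true  = refl
... | false | false = refl

-- Edgewise form of c(f A B) + c(g A B) ≤ c(A) + c(B), where f and g act on the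
-- membership bits of the endpoints in A and B.
Modular : (Bool → Bool → Bool) → (Bool → Bool → Bool) → Set
Modular f g = ∀ a b c d → # (f a b xor f c d) ℕ.+ # (g a b xor g c d) ℕ.≤ # (a xor c) ℕ.+ # (b xor d)

all-Bool? : {P : Bool → Set} → (∀ b → Dec (P b)) → Dec (∀ b → P b)
all-Bool? P? = map′ (λ (t , f) → λ { true → t ; false → f }) (λ p → p true , p false)
                 (P? true ×-dec P? false)

modular? : ∀ f g → Dec (Modular f g)
modular? f g = all-Bool? λ a → all-Bool? λ b → all-Bool? λ c → all-Bool? λ d → _ ℕ.≤? _

-- Submodularity: the bits of intersection and union. All sixteen cases are evaluated.
∧-∨-modular : Modular _∧_ _∨_
∧-∨-modular = from-yes (modular? _∧_ _∨_)

-- Posimodularity: the bits of the two set differences.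
∖-modular : Modular (λ a b → a ∧ not b) (λ a b → b ∧ not a)
∖-modular = from-yes (modular? (λ a b → a ∧ not b) (λ a b → b ∧ not a))

-- Ordered commutative monoids

-- The interface to the reals used by the combinatorial argument. `_≼_` is a preorder over `_≋_`, so
-- `_≋_` may be finer than equality of reals; it is later instantiated with termwise equality of
-- sequences.
record OrderedMonoid : Set₁ where
  infix 4 _≼_
  field
    commutativeMonoid : CommutativeMonoid 0ℓ 0ℓ

  open CommutativeMonoid commutativeMonoid public
    using (setoid; monoid; commutativeSemigroup)
    renaming (Carrier to C; _≈_ to _≋_; _∙_ to _+_; ε to 0#;
              refl to ≋-refl; sym to ≋-sym; trans to ≋-trans; reflexive to ≋-reflexive;
              ∙-cong to +-cong; ∙-congˡ to +-congˡ; assoc to +-assoc; comm to +-comm;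
              identityˡ to +-identityˡ; identityʳ to +-identityʳ)

  field
    _≼_          : Rel C 0ℓ
    ≼-isPreorder : IsPreorder _≋_ _≼_
    +-mono       : _+_ Preserves₂ _≼_ ⟶ _≼_ ⟶ _≼_
    +-cancelʳ    : ∀ {x y} z → (x + z) ≼ (y + z) → x ≼ y

  open IsPreorder ≼-isPreorder public
    using () renaming (refl to ≼-refl; reflexive to ≼-reflexive; trans to ≼-trans)

  preorder : Preorder 0ℓ 0ℓ 0ℓ
  preorder = record { isPreorder = ≼-isPreorder }

-- Finite sums with Boolean coefficients

module CutSums (𝕄 : OrderedMonoid) where

  open OrderedMonoid 𝕄
  open import Algebra.Properties.CommutativeMonoid.Sum commutativeMonoid
    using (sum; sum-cong-≋; sum-replicate-zero; ∑-distrib-+; ∑-comm)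
  open import Algebra.Properties.Monoid.Mult monoid using (×-homo-+) renaming (_×_ to _·_)
  open import Algebra.Properties.CommutativeSemigroup commutativeSemigroup using (interchange)

  infixr 8 _⊙_ ∑-syntax

  ∑-syntax : ∀ n → (Fin n → C) → C
  ∑-syntax _ = sum

  syntax ∑-syntax n (λ i → x) = ∑[ i < n ] x

  _⊙_ : Bool → C → C
  b ⊙ x = if b then x else 0#

  ⊙-congˡ : ∀ b {x y} → x ≋ y → b ⊙ x ≋ b ⊙ y
  ⊙-congˡ true  x≋y = x≋y
  ⊙-congˡ false _   = ≋-refl

  ⊙-zeroʳ : ∀ b → b ⊙ 0# ≋ 0#
  ⊙-zeroʳ true  = ≋-refl
  ⊙-zeroʳ false = ≋-refl

  ⊙-comm : ∀ b c x → b ⊙ c ⊙ x ≋ c ⊙ b ⊙ x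
  ⊙-comm true  c x = ≋-refl
  ⊙-comm false c x = ≋-sym (⊙-zeroʳ c)

  ⊙-distrib-+ : ∀ b x y → b ⊙ (x + y) ≋ b ⊙ x + b ⊙ y
  ⊙-distrib-+ true  x y = ≋-refl
  ⊙-distrib-+ false x y = ≋-sym (+-identityˡ 0#)

  ⊙-distrib-sum : ∀ b {n} (f : Fin n → C) → b ⊙ sum f ≋ ∑[ i < n ] b ⊙ f i
  ⊙-distrib-sum true  f     = ≋-refl
  ⊙-distrib-sum false {n} f = ≋-sym (sum-replicate-zero n)

  #-· : ∀ b x → # b · x ≋ b ⊙ x
  #-· true  x = +-identityʳ x
  #-· false x = ≋-refl

  sumOver : {A : Set} → List A → (A → C) → C
  sumOver xs f = foldr _+_ 0# (map f xs)

  sumOver-cong : {A : Set} (xs : List A) {f g : A → C} →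
                 (∀ x → f x ≋ g x) → sumOver xs f ≋ sumOver xs g
  sumOver-cong []       f≋g = ≋-refl
  sumOver-cong (x ∷ xs) f≋g = +-cong (f≋g x) (sumOver-cong xs f≋g)

  sumOver-++ : {A : Set} (xs ys : List A) (f : A → C) →
               sumOver (xs ++ ys) f ≋ sumOver xs f + sumOver ys f
  sumOver-++ []       ys f = ≋-sym (+-identityˡ _)
  sumOver-++ (x ∷ xs) ys f =
    ≋-trans (+-congˡ (sumOver-++ xs ys f))
      (≋-sym (+-assoc (f x) (sumOver xs f) (sumOver ys f)))

  sumOver-concatMap : {A B : Set} (g : A → List B) (xs : List A) (f : B → C) →
                      sumOver (concatMap g xs) f ≋ sumOver xs (λ x → sumOver (g x) f)
  sumOver-concatMap g []       f = ≋-refl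
  sumOver-concatMap g (x ∷ xs) f =
    ≋-trans (sumOver-++ (g x) (concatMap g xs) f) (+-congˡ (sumOver-concatMap g xs f))

  sumOver-mapMaybe : {A B : Set} (g : A → Maybe B) (xs : List A) (f : B → C) →
                     sumOver (mapMaybe g xs) f ≋ sumOver xs (λ x → maybe′ f 0# (g x))
  sumOver-mapMaybe g []       f = ≋-refl
  sumOver-mapMaybe g (x ∷ xs) f with g x
  ... | just y  = +-congˡ (sumOver-mapMaybe g xs f)
  ... | nothing = ≋-trans (sumOver-mapMaybe g xs f) (≋-sym (+-identityˡ _))

  sumOver-filter : {A : Set} {P : A → Set} (P? : ∀ x → Dec (P x)) (xs : List A) (f : A → C) →
                   sumOver (filter P? xs) f ≋ sumOver xs (λ x → does (P? x) ⊙ f x)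
  sumOver-filter P? []       f = ≋-refl
  sumOver-filter P? (x ∷ xs) f with does (P? x)
  ... | true  = +-congˡ (sumOver-filter P? xs f)
  ... | false = ≋-trans (sumOver-filter P? xs f) (≋-sym (+-identityˡ _))

  sumOver-allFin : ∀ n (f : Fin n → C) → sumOver (allFin n) f ≋ sum f
  sumOver-allFin n f = ≋-trans (≋-reflexive (cong (foldr _+_ 0#) (map-tabulate id f))) (foldr-tabulate f)
    where
    foldr-tabulate : ∀ {m} (g : Fin m → C) → foldr _+_ 0# (tabulateᴸ g) ≋ sum g
    foldr-tabulate {zero}  g = ≋-refl
    foldr-tabulate {suc m} g = +-congˡ (foldr-tabulate (g ∘ suc))

  ∑-select : ∀ {n} (c : Fin n) (f : Fin n → C) → ∑[ a < n ] does (c ≟ᶠ a) ⊙ f a ≋ f c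
  ∑-select {suc n} zero    f = ≋-trans (+-congˡ (sum-replicate-zero n)) (+-identityʳ (f zero))
  ∑-select         (suc c) f = ≋-trans (+-identityˡ _) (∑-select c (f ∘ suc))

  -- Each `u` lies in exactly one fibre, so after exchanging the sums only `a = φ u` contributes.
  ∑-fibres : ∀ {N K} (φ : Fin N → Fin K) (f : Fin K → Fin N → C) →
             ∑[ a < K ] ∑[ u < N ] does (φ u ≟ᶠ a) ⊙ f a u ≋ ∑[ u < N ] f (φ u) u
  ∑-fibres {N} {K} φ f = ≋-trans (∑-comm {K} {N} _) (sum-cong-≋ {N} λ u → ∑-select (φ u) (λ a → f a u))

  -- Cuts as double sums over vertices

  cutSum : ∀ {N} → (Edge N → C) → Subset N → C
  cutSum w W = sumOver (cut W) w

  cutSum-edges : ∀ {N} (w : Edge N → C) (W : Subset N) →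
                cutSum w W ≋ sumOver (edges N) (λ e → separated W e ⊙ w e)
  cutSum-edges {N} w W = ≋-trans (sumOver-filter (crosses? W) (edges N) w)
    (sumOver-cong (edges N) λ e → ≋-reflexive (cong (_⊙ w e) (does-crosses? W e)))

  -- A copy of the helper local to `edges`. Both unfold to the same term, so the list lemmas apply
  -- to `edges N` by definition.
  edgeBetween : ∀ {N} (i j : Fin N) → Maybe (Edge N)
  edgeBetween i j = Maybe.map (λ i<j → i , j , i<j) (dec⇒maybe (i <ᶠ? j))

  sumOver-edges : ∀ {N} (f : Edge N → C) →
                  sumOver (edges N) f ≋ ∑[ i < N ] ∑[ j < N ] maybe′ f 0# (edgeBetween i j)
  sumOver-edges {N} f = begin
    sumOver (edges N) f
      ≈⟨ sumOver-concatMap (λ i → mapMaybe (edgeBetween i) (allFin N)) (allFin N) f ⟩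
    sumOver (allFin N) (λ i → sumOver (mapMaybe (edgeBetween i) (allFin N)) f)
      ≈⟨ sumOver-allFin N _ ⟩
    ∑[ i < N ] sumOver (mapMaybe (edgeBetween i) (allFin N)) f
      ≈⟨ sum-cong-≋ (λ i → ≋-trans (sumOver-mapMaybe (edgeBetween i) (allFin N) f) (sumOver-allFin N _)) ⟩
    ∑[ i < N ] ∑[ j < N ] maybe′ f 0# (edgeBetween i j) ∎
    where open ≋-Reasoning setoid

  -- The weights as a strictly upper triangular matrix, zero elsewhere.
  upper : ∀ {N} → (Edge N → C) → Fin N → Fin N → C
  upper w i j = maybe′ w 0# (edgeBetween i j)

  cutSum-upper : ∀ {N} (w : Edge N → C) (W : Subset N) →
    cutSum w W ≋ ∑[ i < N ] ∑[ j < N ] (lookup W i xor lookup W j) ⊙ upper w i j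
  cutSum-upper {N} w W = ≋-trans (cutSum-edges w W) (≋-trans (sumOver-edges {N} _)
    (sum-cong-≋ {N} λ i → sum-cong-≋ {N} λ j → pull i j))
    where
    pull : ∀ i j → maybe′ (λ e → separated W e ⊙ w e) 0# (edgeBetween i j)
                 ≋ (lookup W i xor lookup W j) ⊙ upper w i j
    pull i j with i <ᶠ? j
    ... | yes _ = ≋-refl
    ... | no  _ = ≋-sym (⊙-zeroʳ (lookup W i xor lookup W j))

  -- An undirected cut is the directed cut of the symmetrized weights, and in
  -- directed form no vertex order has to be respected when vertices are merged.
  cutSum-directed : ∀ {N} (w : Edge N → C) (g : Fin N → Fin N → C) →
    (∀ {i j} → i ≢ j → g i j ≋ upper w i j + upper w j i) → ∀ W →
    cutSum w W ≋ ∑[ i < N ] ∑[ j < N ] (lookup W i ∧ not (lookup W j)) ⊙ g i j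
  cutSum-directed {N} w g g≋ W = ≋-sym (begin
    ∑[ i < N ] ∑[ j < N ] χ i j ⊙ g i j
      ≈⟨ sum-cong-≋ (λ i → sum-cong-≋ λ j → split i j) ⟩
    ∑[ i < N ] ∑[ j < N ] (χ i j ⊙ u i j + χ i j ⊙ u j i)
      ≈⟨ ≋-trans (sum-cong-≋ {N} λ i → ∑-distrib-+ {N} _ _) (∑-distrib-+ {N} _ _) ⟩
    (∑[ i < N ] ∑[ j < N ] χ i j ⊙ u i j) + (∑[ i < N ] ∑[ j < N ] χ i j ⊙ u j i)
      ≈⟨ +-congˡ (∑-comm {N} {N} _) ⟩
    (∑[ i < N ] ∑[ j < N ] χ i j ⊙ u i j) + (∑[ i < N ] ∑[ j < N ] χ j i ⊙ u i j)
      ≈⟨ ≋-trans (sum-cong-≋ {N} λ i → ∑-distrib-+ {N} _ _) (∑-distrib-+ {N} _ _) ⟨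
    ∑[ i < N ] ∑[ j < N ] (χ i j ⊙ u i j + χ j i ⊙ u i j)
      ≈⟨ sum-cong-≋ (λ i → sum-cong-≋ λ j → join (lookup W i) (lookup W j) (u i j)) ⟩
    ∑[ i < N ] ∑[ j < N ] (lookup W i xor lookup W j) ⊙ u i j
      ≈⟨ cutSum-upper w W ⟨
    cutSum w W ∎)
    where
    open ≋-Reasoning setoid
    u = upper w
    χ : Fin N → Fin N → Bool
    χ i j = lookup W i ∧ not (lookup W j)
    split : ∀ i j → χ i j ⊙ g i j ≋ χ i j ⊙ u i j + χ i j ⊙ u j i
    split i j with i ≟ᶠ j
    ... | no i≢j = ≋-trans (⊙-congˡ (χ i j) (g≋ i≢j)) (⊙-distrib-+ (χ i j) (u i j) (u j i))
    -- On the diagonal `χ i i` is false, so `g i i` may be arbitrary. For `pushed` the diagonal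
    -- collects the edges inside a fibre.
    ... | yes refl with lookup W i
    ...   | true  = ≋-sym (+-identityˡ 0#)
    ...   | false = ≋-sym (+-identityˡ 0#)
    join : ∀ a b x → (a ∧ not b) ⊙ x + (b ∧ not a) ⊙ x ≋ (a xor b) ⊙ x
    join true  true  x = +-identityˡ 0#
    join true  false x = +-identityʳ x
    join false true  x = +-identityˡ x
    join false false x = +-identityˡ 0#

  -- Merging vertices along a map

  symmetrized : ∀ {N} → (Edge N → C) → Fin N → Fin N → C
  symmetrized w i j = upper w i j + upper w j i

  module _ {N K : ℕ} (φ : Fin N → Fin K) (w : Edge N → C) where

    private
      δ : Fin N → Fin K → Bool
      δ u a = does (φ u ≟ᶠ a)

      σ = symmetrized w

    -- The total weight between the fibres over `a` and `b`; for `a ≢ b` each original edge between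
    -- them counts once.
    pushed : Fin K → Fin K → C
    pushed a b = ∑[ u < N ] δ u a ⊙ ∑[ v < N ] δ v b ⊙ σ u v

    pushed-sym : ∀ a b → pushed a b ≋ pushed b a
    pushed-sym a b = begin
      ∑[ u < N ] δ u a ⊙ ∑[ v < N ] δ v b ⊙ σ u v
        ≈⟨ sum-cong-≋ (λ u → ⊙-distrib-sum (δ u a) {N} _) ⟩
      ∑[ u < N ] ∑[ v < N ] δ u a ⊙ δ v b ⊙ σ u v
        ≈⟨ ∑-comm {N} {N} _ ⟩
      ∑[ v < N ] ∑[ u < N ] δ u a ⊙ δ v b ⊙ σ u v
        ≈⟨ sum-cong-≋ (λ v → sum-cong-≋ λ u → ≋-trans (⊙-comm (δ u a) (δ v b) (σ u v))
             (⊙-congˡ (δ v b) (⊙-congˡ (δ u a)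
               (+-comm (upper w u v) (upper w v u))))) ⟩
      ∑[ v < N ] ∑[ u < N ] δ v b ⊙ δ u a ⊙ σ v u
        ≈⟨ sum-cong-≋ (λ v → ⊙-distrib-sum (δ v b) {N} _) ⟨
      ∑[ v < N ] δ v b ⊙ ∑[ u < N ] δ u a ⊙ σ v u ∎
      where open ≋-Reasoning setoid

    merge : Edge K → C
    merge (a , b , _) = pushed a b

    pushed≋upper : ∀ {a b} → a ≢ b → pushed a b ≋ upper merge a b + upper merge b a
    pushed≋upper {a} {b} a≢b with a <ᶠ? b | b <ᶠ? a | <-cmp a b
    ... | yes a<b | yes b<a | _            = contradiction b<a (ℕₚ.<-asym a<b)
    ... | yes _   | no  _   | _            = ≋-sym (+-identityʳ _)
    ... | no  _   | yes _   | _            = ≋-trans (pushed-sym a b) (≋-sym (+-identityˡ _))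
    ... | no  a≮b | no  _   | tri< a<b _ _ = contradiction a<b a≮b
    ... | no  _   | no  _   | tri≈ _ a≡b _ = contradiction a≡b a≢b
    ... | no  _   | no  b≮a | tri> _ _ b<a = contradiction b<a b≮a

    -- Merging creates no new cuts: the indicator of `W` at `φ u` and `φ v` is that of the preimage
    -- of `W` at `u` and `v`, and edges inside a fibre cross neither cut.
    cutSum-merge : ∀ W → cutSum merge W ≋ cutSum w (tabulate (lookup W ∘ φ))
    cutSum-merge W = begin
      cutSum merge W
        ≈⟨ cutSum-directed merge pushed pushed≋upper W ⟩
      ∑[ a < K ] ∑[ b < K ] χ a b ⊙ ∑[ u < N ] δ u a ⊙ Q u b
        -- The fibre indicator moves outermost, the form that `∑-fibres` collapses; the same is done
        -- below for `b`.
        ≈⟨ sum-cong-≋ (λ a → sum-cong-≋ λ b → insert (χ a b) (λ u → δ u a) (λ u → Q u b)) ⟩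
      ∑[ a < K ] ∑[ b < K ] ∑[ u < N ] δ u a ⊙ χ a b ⊙ Q u b
        ≈⟨ ∑-comm {K} {K} _ ⟩
      ∑[ b < K ] ∑[ a < K ] ∑[ u < N ] δ u a ⊙ χ a b ⊙ Q u b
        ≈⟨ sum-cong-≋ (λ b → ∑-fibres φ (λ a u → χ a b ⊙ Q u b)) ⟩
      ∑[ b < K ] ∑[ u < N ] χ (φ u) b ⊙ ∑[ v < N ] δ v b ⊙ σ u v
        ≈⟨ ∑-comm {K} {N} _ ⟩
      ∑[ u < N ] ∑[ b < K ] χ (φ u) b ⊙ ∑[ v < N ] δ v b ⊙ σ u v
        ≈⟨ sum-cong-≋ (λ u → sum-cong-≋ λ b → insert (χ (φ u) b) (λ v → δ v b) (σ u)) ⟩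
      ∑[ u < N ] ∑[ b < K ] ∑[ v < N ] δ v b ⊙ χ (φ u) b ⊙ σ u v
        ≈⟨ sum-cong-≋ (λ u → ∑-fibres φ (λ b v → χ (φ u) b ⊙ σ u v)) ⟩
      ∑[ u < N ] ∑[ v < N ] χ (φ u) (φ v) ⊙ σ u v
        ≈⟨ sum-cong-≋ (λ u → sum-cong-≋ λ v → ≋-reflexive (cong₂ (λ p q → (p ∧ not q) ⊙ σ u v)
             (lookup∘tabulate (lookup W ∘ φ) u) (lookup∘tabulate (lookup W ∘ φ) v))) ⟨
      ∑[ u < N ] ∑[ v < N ] (lookup W′ u ∧ not (lookup W′ v)) ⊙ σ u v
        ≈⟨ cutSum-directed w σ (λ _ → ≋-refl) W′ ⟨
      cutSum w W′ ∎
      where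
      open ≋-Reasoning setoid
      W′ = tabulate (lookup W ∘ φ)
      χ : Fin K → Fin K → Bool
      χ a b = lookup W a ∧ not (lookup W b)
      Q : Fin N → Fin K → C
      Q u b = ∑[ v < N ] δ v b ⊙ σ u v
      insert : ∀ c (d : Fin N → Bool) (f : Fin N → C) →
               c ⊙ ∑[ u < N ] d u ⊙ f u ≋ ∑[ u < N ] d u ⊙ c ⊙ f u
      insert c d f = ≋-trans (⊙-distrib-sum c {N} _) (sum-cong-≋ {N} λ u → ⊙-comm c (d u) (f u))

  -- Nonnegativity and uncrossing of cuts

  sum-nonneg : ∀ {n} {f : Fin n → C} → (∀ i → 0# ≼ f i) → 0# ≼ sum f
  sum-nonneg {zero}  _   = ≼-refl
  sum-nonneg {suc n} f≥0 =
    ≼-trans (≼-reflexive (≋-sym (+-identityˡ 0#))) (+-mono (f≥0 zero) (sum-nonneg (f≥0 ∘ suc)))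

  ·-mono-≼ : ∀ {m n x} → 0# ≼ x → m ≤ n → (m · x) ≼ (n · x)
  ·-mono-≼ {n = zero}  x≥0 z≤n = ≼-refl
  ·-mono-≼ {n = suc n} x≥0 z≤n =
    ≼-trans (≼-reflexive (≋-sym (+-identityˡ 0#))) (+-mono x≥0 (·-mono-≼ {n = n} x≥0 z≤n))
  ·-mono-≼ x≥0 (s≤s m≤n) = +-mono ≼-refl (·-mono-≼ x≥0 m≤n)

  ⊙-nonneg : ∀ b {x} → 0# ≼ x → 0# ≼ (b ⊙ x)
  ⊙-nonneg true  x≥0 = x≥0
  ⊙-nonneg false _   = ≼-refl

  upper-nonneg : ∀ {N} {w : Edge N → C} → (∀ e → 0# ≼ w e) → ∀ i j → 0# ≼ upper w i j
  upper-nonneg w≥0 i j with i <ᶠ? j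
  ... | yes i<j = w≥0 (i , j , i<j)
  ... | no  _   = ≼-refl

  merge-nonneg : ∀ {N K} (φ : Fin N → Fin K) {w : Edge N → C} →
                 (∀ e → 0# ≼ w e) → ∀ e → 0# ≼ merge φ w e
  merge-nonneg φ w≥0 (a , b , _) =
    sum-nonneg λ u → ⊙-nonneg (does (φ u ≟ᶠ a)) (
    sum-nonneg λ v → ⊙-nonneg (does (φ v ≟ᶠ b)) (
    ≼-trans (≼-reflexive (≋-sym (+-identityˡ 0#)))
            (+-mono (upper-nonneg w≥0 u v) (upper-nonneg w≥0 v u))))

  -- Both sides are natural multiples of `x`, so comparing the coefficients suffices.
  ⊙-mono-# : ∀ p q r s {x} → 0# ≼ x → # p ℕ.+ # q ≤ # r ℕ.+ # s →
             (p ⊙ x + q ⊙ x) ≼ (r ⊙ x + s ⊙ x)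
  ⊙-mono-# p q r s {x} x≥0 pq≤rs = begin
    p ⊙ x + q ⊙ x       ≈⟨ count p q ⟨
    (# p ℕ.+ # q) · x   ≲⟨ ·-mono-≼ x≥0 pq≤rs ⟩
    (# r ℕ.+ # s) · x   ≈⟨ count r s ⟩
    r ⊙ x + s ⊙ x       ∎
    where
    open ≼-Reasoning preorder
    count : ∀ a b → (# a ℕ.+ # b) · x ≋ a ⊙ x + b ⊙ x
    count a b = ≋-trans (×-homo-+ x (# a) (# b)) (+-cong (#-· a x) (#-· b x))

  -- The hypothesis compares pairs because uncrossing may make one of the two cuts heavier; only the
  -- sum of both is controlled.
  sumOver-pair-mono : {A : Set} (xs : List A) {p q r s : A → C} →
    (∀ x → (p x + q x) ≼ (r x + s x)) →
    (sumOver xs p + sumOver xs q) ≼ (sumOver xs r + sumOver xs s)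
  sumOver-pair-mono []       _                     = ≼-refl
  sumOver-pair-mono (x ∷ xs) {p} {q} {r} {s} pq≤rs = begin
    (p x + Σ[ p ]) + (q x + Σ[ q ])   ≈⟨ interchange (p x) Σ[ p ] (q x) Σ[ q ] ⟩
    (p x + q x) + (Σ[ p ] + Σ[ q ])   ≲⟨ +-mono (pq≤rs x) (sumOver-pair-mono xs pq≤rs) ⟩
    (r x + s x) + (Σ[ r ] + Σ[ s ])   ≈⟨ interchange (r x) (s x) Σ[ r ] Σ[ s ] ⟩
    (r x + Σ[ r ]) + (s x + Σ[ s ])   ∎
    where
    open ≼-Reasoning preorder
    Σ[_] = sumOver xs

  -- The bitwise inequality holds at each edge, survives scaling by its nonnegative weight, and is
  -- summed over all edges.
  cutSum-uncross : ∀ {N} {w : Edge N → C} → (∀ e → 0# ≼ w e) → ∀ {f g} → Modular f g → ∀ A B →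
    (cutSum w (zipWith f A B) + cutSum w (zipWith g A B)) ≼ (cutSum w A + cutSum w B)
  cutSum-uncross {N} {w} w≥0 {f} {g} fg-modular A B = begin
    cutSum w (zipWith f A B) + cutSum w (zipWith g A B)
      ≈⟨ +-cong (cutSum-edges w (zipWith f A B)) (cutSum-edges w (zipWith g A B)) ⟩
    sumOver (edges N) (χ (zipWith f A B)) + sumOver (edges N) (χ (zipWith g A B))
      ≲⟨ sumOver-pair-mono (edges N) edgewise ⟩
    sumOver (edges N) (χ A) + sumOver (edges N) (χ B)
      ≈⟨ +-cong (cutSum-edges w A) (cutSum-edges w B) ⟨
    cutSum w A + cutSum w B ∎
    where
    open ≼-Reasoning preorder
    χ : Subset N → Edge N → C
    χ W e = separated W e ⊙ w e
    edgewise : ∀ e → (χ (zipWith f A B) e + χ (zipWith g A B) e) ≼ (χ A e + χ B e)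
    edgewise e@(i , j , _)
      rewrite lookup-zipWith f i A B | lookup-zipWith f j A B
            | lookup-zipWith g i A B | lookup-zipWith g j A B =
      ⊙-mono-# _ _ (separated A e) (separated B e) (w≥0 e)
        (fg-modular (lookup A i) (lookup B i) (lookup A j) (lookup B j))

-- Minimal elements and enumeration of families

-- Excluded middle decides whether a smaller witness exists, and accessibility ends the descent. It
-- stands in for a decision procedure for `P`, which may involve the order of the reals.
minimal : ExcludedMiddle 0ℓ → {A : Set} {_⋖_ : Rel A 0ℓ} → WellFounded _⋖_ →
          (P : A → Set) → ∃ P → ∃ λ a → P a × (∀ {b} → P b → ¬ b ⋖ a)
minimal em {A} {_⋖_} wf P (a , pa) = descend (wf a) pa
  where
  descend : ∀ {a} → Acc _⋖_ a → P a → ∃ λ a → P a × (∀ {b} → P b → ¬ b ⋖ a)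
  descend {a} (acc rs) pa with em {∃ λ b → P b × b ⋖ a}
  ... | yes (b , pb , b⋖a) = descend (rs b⋖a) pb
  ... | no  none           = a , pa , λ pb b⋖a → none (_ , pb , b⋖a)

least-exists : ExcludedMiddle 0ℓ → ∀ {P : ℕ → Set} {k} → P k → ∃ λ m → Least P m × m ≤ k
least-exists em {P} {k} pk with minimal em <-wellFounded P (k , pk)
... | m , pm , m-minimal = m , (pm , λ _ pj → ℕₚ.≮⇒≥ (m-minimal pj)) , ℕₚ.≮⇒≥ (m-minimal pk)

⊆∧⊄⇒≡ : ∀ {n} {A B : Subset n} → A ⊆ B → ¬ A ⊂ B → A ≡ B
⊆∧⊄⇒≡ {A = A} A⊆B A⊄B = ⊆-antisym A⊆B λ {x} x∈B →
  decidable-stable (x ∈? A) λ x∉A → A⊄B (A⊆B , x , x∈B , x∉A)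

∈-subsets : ∀ {n} (A : Subset n) → A ∈ᴸ subsets n
∈-subsets []            = Any.here refl
∈-subsets (outside ∷ A) = ∈-++⁺ˡ (∈-map⁺ (outside ∷_) (∈-subsets A))
∈-subsets (inside ∷ A)  = ∈-++⁺ʳ _ (∈-map⁺ (inside ∷_) (∈-subsets A))

-- Places a family cut out by a predicate in `families` as a literal list, with no reordering.
filter∈sublists : {A : Set} {P : A → Set} (P? : ∀ x → Dec (P x)) (xs : List A) →
                  filter P? xs ∈ᴸ sublists xs
filter∈sublists P? []       = Any.here refl
filter∈sublists P? (x ∷ xs) with does (P? x)
... | true  = ∈-++⁺ʳ (sublists xs) (∈-map⁺ (x ∷_) (filter∈sublists P? xs))
... | false = ∈-++⁺ˡ (filter∈sublists P? xs)

-- Permutations aligning two injections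

transpose-fst : ∀ {n} (i j : Fin n) → transpose i j ⟨$⟩ʳ i ≡ j
transpose-fst i j rewrite dec-true (i ≟ᶠ i) refl = refl

transpose-other : ∀ {n} (i j : Fin n) {k} → k ≢ i → k ≢ j → transpose i j ⟨$⟩ʳ k ≡ k
transpose-other i j {k} k≢i k≢j
  rewrite dec-false (k ≟ᶠ i) k≢i | dec-false (k ≟ᶠ j) k≢j = refl

⟨$⟩ʳ-injective : ∀ {n} (π : Permutation′ n) → Injective _≡_ _≡_ (π ⟨$⟩ʳ_)
⟨$⟩ʳ-injective π = Injection.injective (↔⇒↣ π)

-- Induction aligns all points but the first; a transposition then moves the first one to its
-- target. Injectivity of `f` and `g` keeps that transposition off the points already placed.
injections-align : ∀ {m n} {f g : Fin m → Fin n} →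
                   Injective _≡_ _≡_ f → Injective _≡_ _≡_ g →
                   ∃ λ (π : Permutation′ n) → ∀ i → π ⟨$⟩ʳ f i ≡ g i
injections-align {zero}          f-inj g-inj = Perm.id , λ ()
injections-align {suc m} {n} {f} {g} f-inj g-inj
  with injections-align {f = f ∘ suc} {g ∘ suc} (suc-injective ∘ f-inj) (suc-injective ∘ g-inj)
... | π , πf≡g = π ∘ₚ τ , aligned
  where
  τ = transpose (π ⟨$⟩ʳ f zero) (g zero)
  aligned : ∀ i → τ ⟨$⟩ʳ (π ⟨$⟩ʳ f i) ≡ g i
  aligned zero    = transpose-fst (π ⟨$⟩ʳ f zero) (g zero)
  aligned (suc i) = trans
    (transpose-other (π ⟨$⟩ʳ f zero) (g zero)
      (λ eq → contradiction (f-inj (⟨$⟩ʳ-injective π eq)) λ ())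
      (λ eq → contradiction (g-inj (trans (sym (πf≡g i)) eq)) λ ()))
    (πf≡g i)

-- Terminals and sink as marked vertices

sink : ∀ {n N} → n < N → Fin N
sink {N = suc N} _ = fromℕ N

sink-isSink : ∀ {n N} (n<N : n < N) → IsSink (sink n<N)
sink-isSink {N = suc N} _ = cong suc (toℕ-fromℕ N)

isSink⇒≡sink : ∀ {n N} (n<N : n < N) {v} → IsSink v → v ≡ sink n<N
isSink⇒≡sink n<N v-sink =
  toℕ-injective (ℕₚ.suc-injective (trans v-sink (sym (sink-isSink n<N))))

marked : ∀ {n N} → n < N → Fin (suc n) → Fin N
marked n<N zero    = sink n<N
marked n<N (suc i) = terminal n<N i

marked-injective : ∀ {n N} (n<N : n < N) → Injective _≡_ _≡_ (marked n<N)
marked-injective n<N {zero}  {zero}  eq = refl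
marked-injective n<N {suc i} {suc j} eq = cong suc (inject≤-injective _ _ i j eq)
marked-injective n<N {zero}  {suc j} eq = contradiction eq (sink≢terminal n<N j)
  where
  sink≢terminal : ∀ {n N} (n<N : n < N) j → sink n<N ≢ terminal n<N j
  sink≢terminal {n} {N} n<N j eq = ℕₚ.<-irrefl N≡ (ℕₚ.≤-trans (s≤s (toℕ<n j)) n<N)
    where
    N≡ : suc (toℕ j) ≡ N
    N≡ = trans (cong suc (trans (sym (toℕ-inject≤ j _)) (cong toℕ (sym eq)))) (sink-isSink n<N)
marked-injective n<N {suc i} {zero}  eq = sym (marked-injective n<N (sym eq))

-- The `n + 1` marked vertices have distinct values under `c`, which forces `n < K`. A permutation
-- of `Fin K` then moves these values to the prescribed places and, being injective, identifies no
-- further vertices.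
relabel : ∀ {n N K} (n<N : n < N) (c : Fin N → Fin K) → Injective _≡_ _≡_ (c ∘ marked n<N) →
  Σ (n < K) λ n<K → ∃ λ (φ : Fin N → Fin K) →
    (∀ i → φ (marked n<N i) ≡ marked n<K i) × (∀ {u v} → φ u ≡ φ v → c u ≡ c v)
relabel n<N c c-inj =
  let n<K      = injective⇒≤ c-inj
      π , πc≡  = injections-align c-inj (marked-injective n<K)
  in n<K , (π ⟨$⟩ʳ_) ∘ c , πc≡ , ⟨$⟩ʳ-injective π

-- Both requirements of Separates in one: the sink is an extra terminal that
-- lies in no set I.
Splits : ∀ {n N} → n < N → Subset n → Subset N → Set
Splits n<N I W = ∀ i → lookup W (marked n<N i) ≡ lookup (outside ∷ I) i

∉⇒lookup : ∀ {n} {v : Fin n} {W} → v ∉ W → lookup W v ≡ outside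
∉⇒lookup {v = v} {W} v∉W with lookup W v in eq
... | outside = refl
... | inside  = contradiction (lookup⇒[]= v W eq) v∉W

lookup⇒∉ : ∀ {n} {v : Fin n} {W} → lookup W v ≡ outside → v ∉ W
lookup⇒∉ eq v∈W = contradiction (trans (sym eq) ([]=⇒lookup v∈W)) λ ()

∈⇔⇒lookup≡ : ∀ {m n} {u : Fin m} {v : Fin n} {A B} → u ∈ A ⇔ v ∈ B → lookup A u ≡ lookup B v
∈⇔⇒lookup≡ {u = u} {v} {A} {B} A⇔B = ⇔→≡ (mk⇔
  (λ eq → []=⇒lookup (Equivalence.to A⇔B (lookup⇒[]= u A eq)))
  (λ eq → []=⇒lookup (Equivalence.from A⇔B (lookup⇒[]= v B eq))))

lookup≡⇒∈⇔ : ∀ {m n} {u : Fin m} {v : Fin n} {A B} → lookup A u ≡ lookup B v → u ∈ A ⇔ v ∈ B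
lookup≡⇒∈⇔ {u = u} {v} {A} {B} eq = mk⇔
  (λ u∈A → lookup⇒[]= v B (trans (sym eq) ([]=⇒lookup u∈A)))
  (λ v∈B → lookup⇒[]= u A (trans eq ([]=⇒lookup v∈B)))

separates⇒splits : ∀ {n N} (n<N : n < N) {I W} → Separates n<N I W → Splits n<N I W
separates⇒splits n<N (sink∉ , _)    zero    = ∉⇒lookup (sink∉ _ (sink-isSink n<N))
separates⇒splits n<N (_ , terminals) (suc i) = ∈⇔⇒lookup≡ (terminals i)

splits⇒separates : ∀ {n N} (n<N : n < N) {I W} → Splits n<N I W → Separates n<N I W
splits⇒separates n<N splits =
  (λ v v-sink v∈W → lookup⇒∉ (splits zero) (subst (_∈ _) (isSink⇒≡sink n<N v-sink) v∈W)) ,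
  λ i → lookup≡⇒∈⇔ (splits (suc i))

-- Uncrossing minimum cuts

module Realization (em : ExcludedMiddle 0ℓ) (𝕄 : OrderedMonoid) where

  open OrderedMonoid 𝕄
  open CutSums 𝕄

  -- The form of `Realizes` in which attainment is an inequality; the lower bound for all cuts gives
  -- the reverse one.
  MinimumCuts : ∀ {n N} → n < N → (Edge N → C) → ((I : Subset n) → .(Nonempty I) → C) → Set
  MinimumCuts n<N w S = ∀ I .(I≠∅ : Nonempty I) →
    (∃ λ W → Splits n<N I W × cutSum w W ≼ S I I≠∅) ×
    (∀ W → Splits n<N I W → S I I≠∅ ≼ cutSum w W)

  module _ {n N} (n<N : n < N) {w : Edge N → C} (w≥0 : ∀ e → 0# ≼ w e)
           {S : (I : Subset n) → .(Nonempty I) → C} (min-cuts : MinimumCuts n<N w S) where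

    Tight : (I : Subset n) → .(Nonempty I) → Subset N → Set
    Tight I I≠∅ W = Splits n<N I W × cutSum w W ≼ S I I≠∅

    tightest : ∀ I .(I≠∅ : Nonempty I) →
               ∃ λ W → Tight I I≠∅ W × (∀ {V} → Tight I I≠∅ V → ¬ V ⊂ W)
    tightest I I≠∅ = minimal em ⊂-wellFounded (Tight I I≠∅) (proj₁ (min-cuts I I≠∅))

    -- Irrelevance of the nonemptiness proof fixes a single cut for each `I`.
    tight : (I : Subset n) → .(Nonempty I) → Subset N
    tight I I≠∅ = proj₁ (tightest I I≠∅)

    splits-zipWith : ∀ f A B {I J K} → f outside outside ≡ outside →
      (∀ i → f (lookup I i) (lookup J i) ≡ lookup K i) →
      Splits n<N I A → Splits n<N J B → Splits n<N K (zipWith f A B)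
    splits-zipWith f A B {I} {J} {K} f-out f-IJ I-A J-B i = begin
      lookup (zipWith f A B) (marked n<N i)                     ≡⟨ lookup-zipWith f (marked n<N i) A B ⟩
      f (lookup A (marked n<N i)) (lookup B (marked n<N i))     ≡⟨ cong₂ f (I-A i) (J-B i) ⟩
      f (lookup (outside ∷ I) i) (lookup (outside ∷ J) i)       ≡⟨ f-IJ′ i ⟩
      lookup (outside ∷ K) i                                    ∎
      where
      open ≡-Reasoning
      f-IJ′ : ∀ i → f (lookup (outside ∷ I) i) (lookup (outside ∷ J) i) ≡ lookup (outside ∷ K) i
      f-IJ′ zero    = f-out
      f-IJ′ (suc i) = f-IJ i

    -- The cut g A B separates J, so it weighs at least S J. Hence f A B is again
    -- a minimum cut for I, and f A B ⊆ A cannot be proper.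
    uncross : ∀ {I J} (I≠∅ : Nonempty I) (J≠∅ : Nonempty J) f g → Modular f g →
      (∀ {a b} → f a b ≡ inside → a ≡ inside) → f outside outside ≡ outside → g outside outside ≡ outside →
      (∀ i → f (lookup I i) (lookup J i) ≡ lookup I i) →
      (∀ i → g (lookup I i) (lookup J i) ≡ lookup J i) →
      ∀ {v} → v ∈ tight I I≠∅ → f inside (lookup (tight J J≠∅) v) ≡ inside
    uncross {I} {J} I≠∅ J≠∅ f g fg-modular f⊆ f-out g-out f-IJ g-IJ {v} v∈A
      with tightest I I≠∅ | tightest J J≠∅
    ... | A , (I-A , A≼) , A-minimal | B , (J-B , B≼) , _ =
      subst (λ a → f a (lookup B v) ≡ inside) ([]=⇒lookup v∈A)
        (trans (sym (lookup-zipWith f v A B)) ([]=⇒lookup v∈X))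
      where
      X = zipWith f A B
      Y = zipWith g A B
      X≼ : cutSum w X ≼ S I I≠∅
      X≼ = +-cancelʳ (S J J≠∅) (begin
        cutSum w X + S J J≠∅
          ≲⟨ +-mono ≼-refl (proj₂ (min-cuts J J≠∅) Y (splits-zipWith g A B g-out g-IJ I-A J-B)) ⟩
        cutSum w X + cutSum w Y   ≲⟨ cutSum-uncross w≥0 {f} {g} fg-modular A B ⟩
        cutSum w A + cutSum w B   ≲⟨ +-mono A≼ B≼ ⟩
        S I I≠∅ + S J J≠∅         ∎)
        where open ≼-Reasoning preorder
      X⊆A : X ⊆ A
      X⊆A {x} x∈X = lookup⇒[]= x A
        (f⊆ (trans (sym (lookup-zipWith f x A B)) ([]=⇒lookup x∈X)))
      v∈X : v ∈ X
      v∈X = subst (v ∈_)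
        (sym (⊆∧⊄⇒≡ X⊆A (A-minimal (splits-zipWith f A B f-out f-IJ I-A J-B , X≼)))) v∈A

    -- For `I ⊆ J` the intersection of the traces is `I` and their union is `J`, so `uncross`
    -- applies with `_∧_` and `_∨_`. Its conclusion `inside ∧ b ≡ inside` reduces to membership in
    -- the cut of `J`.
    tight-mono : ∀ {I J} (I≠∅ : Nonempty I) (J≠∅ : Nonempty J) →
                 I ⊆ J → tight I I≠∅ ⊆ tight J J≠∅
    tight-mono {I} {J} I≠∅ J≠∅ I⊆J {v} v∈A =
      lookup⇒[]= v _ (uncross I≠∅ J≠∅ _∧_ _∨_ ∧-∨-modular ∧-inside refl refl I∧J I∨J v∈A)
      where
      ∧-inside : ∀ {a b} → a ∧ b ≡ inside → a ≡ inside
      ∧-inside {inside} _ = refl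
      I∧J : ∀ i → lookup I i ∧ lookup J i ≡ lookup I i
      I∧J i with lookup I i in eq
      ... | inside  = []=⇒lookup (I⊆J (lookup⇒[]= i I eq))
      ... | outside = refl
      I∨J : ∀ i → lookup I i ∨ lookup J i ≡ lookup J i
      I∨J i with lookup I i in eq
      ... | inside  = sym ([]=⇒lookup (I⊆J (lookup⇒[]= i I eq)))
      ... | outside = refl

    -- Disjoint `I` and `J` equal their own differences, so `uncross` with the two differences puts
    -- every vertex of the cut of `I` outside the cut of `J`.
    tight-intersecting : ∀ {I J} (I≠∅ : Nonempty I) (J≠∅ : Nonempty J) →
      ∀ {v} → v ∈ tight I I≠∅ → v ∈ tight J J≠∅ → Nonempty (I ∩ J)
    tight-intersecting {I} {J} I≠∅ J≠∅ {v} v∈A v∈B =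
      decidable-stable (nonempty? (I ∩ J)) λ disjoint →
      contradiction
        (trans (sym (uncross I≠∅ J≠∅ (λ a b → a ∧ not b) (λ a b → b ∧ not a) ∖-modular
                       ∖-inside refl refl (I∖J disjoint) (J∖I disjoint) v∈A))
               (cong not ([]=⇒lookup v∈B)))
        λ ()
      where
      ∖-inside : ∀ {a b} → a ∧ not b ≡ inside → a ≡ inside
      ∖-inside {inside} _ = refl
      I∖J : ¬ Nonempty (I ∩ J) → ∀ i → lookup I i ∧ not (lookup J i) ≡ lookup I i
      I∖J disjoint i with lookup I i in eqI | lookup J i in eqJ
      ... | outside | _       = refl
      ... | inside  | outside = refl
      ... | inside  | inside  =
        contradiction (i , x∈p∩q⁺ (lookup⇒[]= i I eqI , lookup⇒[]= i J eqJ)) disjoint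
      J∖I : ¬ Nonempty (I ∩ J) → ∀ i → lookup J i ∧ not (lookup I i) ≡ lookup J i
      J∖I disjoint i with lookup I i in eqI | lookup J i in eqJ
      ... | _       | outside = refl
      ... | outside | inside  = refl
      ... | inside  | inside  =
        contradiction (i , x∈p∩q⁺ (lookup⇒[]= i I eqI , lookup⇒[]= i J eqJ)) disjoint

    -- Signatures and their antichains

    Signature : Fin N → Subset n → Set
    Signature v I = Σ (Nonempty I) λ I≠∅ → v ∈ tight I I≠∅

    Generator : Fin N → Subset n → Set
    Generator v I = Signature v I × (∀ {J} → Signature v J → ¬ J ⊂ I)

    -- Filtering the list from which `families n` is built makes the result literally one of its
    -- entries.
    generators : Fin N → List (Subset n)
    generators v = filter (λ I → em {Generator v I}) (filter nonempty? (subsets n))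

    ∈-generators⁺ : ∀ {v I} → Generator v I → I ∈ᴸ generators v
    ∈-generators⁺ {v} {I} gen@((I≠∅ , _) , _) =
      ∈-filter⁺ (λ I → em {Generator v I}) (∈-filter⁺ nonempty? (∈-subsets I) I≠∅) gen

    ∈-generators⁻ : ∀ {v I} → I ∈ᴸ generators v → Generator v I
    ∈-generators⁻ {v} I∈ =
      proj₂ (∈-filter⁻ (λ I → em {Generator v I}) {xs = filter nonempty? (subsets n)} I∈)

    generators-antichain : ∀ v → Antichain (generators v)
    generators-antichain v = All.tabulate λ I∈ → All.tabulate λ J∈ I⊆J →
      ⊆∧⊄⇒≡ I⊆J (proj₂ (∈-generators⁻ J∈) (proj₁ (∈-generators⁻ I∈)))

    generators-intersecting : ∀ v → PairwiseIntersecting (generators v)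
    generators-intersecting v = All.tabulate λ I∈ → All.tabulate λ J∈ →
      intersecting (proj₁ (∈-generators⁻ I∈)) (proj₁ (∈-generators⁻ J∈))
      where
      intersecting : ∀ {I J} → Signature v I → Signature v J → Nonempty (I ∩ J)
      intersecting (I≠∅ , v∈A) (J≠∅ , v∈B) = tight-intersecting I≠∅ J≠∅ v∈A v∈B

    intersectingAntichains : List (List (Subset n))
    intersectingAntichains =
      filter (λ F → antichain? F ×-dec pairwiseIntersecting? F) (families n)

    generators∈ : ∀ v → generators v ∈ᴸ intersectingAntichains
    generators∈ v = ∈-filter⁺ (λ F → antichain? F ×-dec pairwiseIntersecting? F)
      (filter∈sublists (λ I → em {Generator v I}) (filter nonempty? (subsets n)))
      (generators-antichain v , generators-intersecting v)

    -- `M n` is by definition the length of `intersectingAntichains`, so a position in that list is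
    -- an element of `Fin (M n)`.
    class : Fin N → Fin (M n)
    class v = Any.index (generators∈ v)

    class≡⇒generators≡ : ∀ {u v} → class u ≡ class v → generators u ≡ generators v
    class≡⇒generators≡ {u} {v} eq = begin
      generators u                              ≡⟨ lookup-index (generators∈ u) ⟩
      lookupᴸ intersectingAntichains (class u)  ≡⟨ cong (lookupᴸ intersectingAntichains) eq ⟩
      lookupᴸ intersectingAntichains (class v)  ≡⟨ lookup-index (generators∈ v) ⟨
      generators v                              ∎
      where open ≡-Reasoning

    -- Below `I` lies a minimal member `J` of the signature of `u`. It is a generator of `u`, hence
    -- of `v`, and `tight-mono` leads from `J` back up to `I`.
    class≡⇒signature : ∀ {u v I} → class u ≡ class v → Signature u I → Signature v I
    class≡⇒signature {u} {v} {I} eq sig@(I≠∅ , _) =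
      transfer (minimal em ⊂-wellFounded (λ J → J ⊆ I × Signature u J) (I , id , sig))
      where
      transfer : (∃ λ J → (J ⊆ I × Signature u J) ×
                          (∀ {J′} → J′ ⊆ I × Signature u J′ → ¬ J′ ⊂ J)) → Signature v I
      transfer (J , (J⊆I , u∈J) , J-minimal) = I≠∅ , tight-mono J≠∅ I≠∅ J⊆I v∈B
        where
        J-generates : Generator u J
        -- Minimality among the subsets of `I` is minimality outright, since anything below `J` is
        -- below `I`.
        J-generates = u∈J , λ sig′ J′⊂J → J-minimal (⊆-trans (proj₁ J′⊂J) J⊆I , sig′) J′⊂J
        v∈J : Signature v J
        v∈J = proj₁ (∈-generators⁻ (subst (J ∈ᴸ_) (class≡⇒generators≡ eq) (∈-generators⁺ J-generates)))
        J≠∅ = proj₁ v∈J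
        v∈B = proj₂ v∈J

    tight-splits : ∀ I .(I≠∅ : Nonempty I) → Splits n<N I (tight I I≠∅)
    tight-splits I I≠∅ = proj₁ (proj₁ (proj₂ (tightest I I≠∅)))

    tight-minimum : ∀ I .(I≠∅ : Nonempty I) → cutSum w (tight I I≠∅) ≼ S I I≠∅
    tight-minimum I I≠∅ = proj₂ (proj₁ (proj₂ (tightest I I≠∅)))

    terminal-signature : ∀ i → Signature (terminal n<N i) ⁅ i ⁆
    terminal-signature i = (i , x∈⁅x⁆ i) ,
      lookup⇒[]= (terminal n<N i) _ (trans (tight-splits ⁅ i ⁆ (i , x∈⁅x⁆ i) (suc i)) ([]=⇒lookup (x∈⁅x⁆ i)))

    terminal-signature⁻ : ∀ {i I} → Signature (terminal n<N i) I → i ∈ I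
    terminal-signature⁻ {i} {I} (I≠∅ , i∈A) =
      lookup⇒[]= i I (trans (sym (tight-splits I I≠∅ (suc i))) ([]=⇒lookup i∈A))

    sink-signature : ∀ {I} → ¬ Signature (sink n<N) I
    sink-signature {I} (I≠∅ , sink∈A) = lookup⇒∉ (tight-splits I I≠∅ zero) sink∈A

    -- The singleton of `i` is in the signature of terminal `i`, in that of terminal `j` only if
    -- `j ≡ i`, and never in that of the sink.
    class-marked-injective : Injective _≡_ _≡_ (class ∘ marked n<N)
    class-marked-injective {zero}  {zero}  eq = refl
    class-marked-injective {suc i} {zero}  eq =
      contradiction (class≡⇒signature eq (terminal-signature i)) sink-signature
    class-marked-injective {zero}  {suc j} eq =
      contradiction (class≡⇒signature (sym eq) (terminal-signature j)) sink-signature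
    class-marked-injective {suc i} {suc j} eq = cong suc (sym (x∈⁅y⁆⇒x≡y i
      (terminal-signature⁻ (class≡⇒signature eq (terminal-signature i)))))

    -- Minimum cuts after merging

    module _ {K} (n<K : n < K) (φ : Fin N → Fin K)
             (φ-marked : ∀ i → φ (marked n<N i) ≡ marked n<K i)
             (φ-signature : ∀ {u v I} → φ u ≡ φ v → Signature u I → Signature v I) where

      pullback : Subset K → Subset N
      pullback V = tabulate (lookup V ∘ φ)

      pullback-marked : ∀ V i → lookup (pullback V) (marked n<N i) ≡ lookup V (marked n<K i)
      pullback-marked V i =
        trans (lookup∘tabulate (lookup V ∘ φ) (marked n<N i)) (cong (lookup V) (φ-marked i))

      module _ (I : Subset n) (I≠∅ : Nonempty I) where

        image? : ∀ a → Dec (∃ λ u → φ u ≡ a × u ∈ tight I I≠∅)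
        image? a = any? λ u → (φ u ≟ᶠ a) ×-dec (u ∈? tight I I≠∅)

        image : Subset K
        image = tabulate (does ∘ image?)

        -- Vertices with equal image share their signature, so the chosen cut is a union of fibres
        -- and its image pulls back to nothing more.
        pullback-image : pullback image ≡ tight I I≠∅
        pullback-image = trans (tabulate-cong saturated) (tabulate∘lookup _)
          where
          saturated : ∀ v → lookup image (φ v) ≡ lookup (tight I I≠∅) v
          saturated v = begin
            lookup image (φ v)          ≡⟨ lookup∘tabulate (does ∘ image?) (φ v) ⟩
            does (image? (φ v))         ≡⟨ does-⇔ preimage⇔ (image? (φ v)) (v ∈? tight I I≠∅) ⟩
            does (v ∈? tight I I≠∅)     ≡⟨ does-∈? v (tight I I≠∅) ⟩
            lookup (tight I I≠∅) v      ∎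
            where
            open ≡-Reasoning
            preimage⇔ : (∃ λ u → φ u ≡ φ v × u ∈ tight I I≠∅) ⇔ v ∈ tight I I≠∅
            preimage⇔ = mk⇔
              (λ (u , φu≡φv , u∈A) → proj₂ (φ-signature φu≡φv (I≠∅ , u∈A)))
              (λ v∈A → v , refl , v∈A)

        image-splits : Splits n<K I image
        image-splits i = begin
          lookup image (marked n<K i)              ≡⟨ pullback-marked image i ⟨
          lookup (pullback image) (marked n<N i)   ≡⟨ cong (λ W → lookup W (marked n<N i)) pullback-image ⟩
          lookup (tight I I≠∅) (marked n<N i)      ≡⟨ tight-splits I I≠∅ i ⟩
          lookup (outside ∷ I) i                   ∎
          where open ≡-Reasoning

        image-minimum : cutSum (merge φ w) image ≼ S I I≠∅
        image-minimum = ≼-trans (≼-reflexive (cutSum-merge φ w image))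
          (subst (λ W → cutSum w W ≼ S I I≠∅) (sym pullback-image) (tight-minimum I I≠∅))

      -- A cut of the merged graph pulls back to an original cut of equal weight, where the bound is
      -- known.
      merge-bound : ∀ I .(I≠∅ : Nonempty I) V → Splits n<K I V → S I I≠∅ ≼ cutSum (merge φ w) V
      merge-bound I I≠∅ V splits =
        ≼-trans (proj₂ (min-cuts I I≠∅) (pullback V) (λ i → trans (pullback-marked V i) (splits i)))
                (≼-reflexive (≋-sym (cutSum-merge φ w V)))

      merge-minimumCuts : MinimumCuts n<K (merge φ w) S
      merge-minimumCuts I I≠∅ =
        (image I I≠∅′ , image-splits I I≠∅′ , image-minimum I I≠∅′) , merge-bound I I≠∅
        where
        I≠∅′ : Nonempty I
        -- Decidability recovers a relevant witness, which `image` takes as an argument.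
        I≠∅′ = recompute (nonempty? I) I≠∅

    minimumCuts-compress : Σ (n < M n) λ n<M → ∃ λ (w′ : Edge (M n) → C) →
                           (∀ e → 0# ≼ w′ e) × MinimumCuts n<M w′ S
    minimumCuts-compress = compress (relabel n<N class class-marked-injective)
      where
      compress : (Σ (n < M n) λ n<M → ∃ λ (φ : Fin N → Fin (M n)) →
                   (∀ i → φ (marked n<N i) ≡ marked n<M i) × (∀ {u v} → φ u ≡ φ v → class u ≡ class v)) →
                 Σ (n < M n) λ n<M → ∃ λ w′ → (∀ e → 0# ≼ w′ e) × MinimumCuts n<M w′ S
      compress (n<M , φ , φ-marked , φ≡⇒class≡) =
        n<M , merge φ w , merge-nonneg φ w≥0 ,
        merge-minimumCuts n<M φ φ-marked λ {u} {v} {I} φu≡φv →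
          class≡⇒signature {u} {v} {I} (φ≡⇒class≡ φu≡φv)

-- Cauchy reals as an ordered monoid

infix 4 _≐_

-- Termwise equality of Cauchy sequences. It implies _≈_, and unlike _≈_ it
-- makes ℝ a commutative monoid with no estimates.
record _≐_ (x y : ℝ) : Set where
  constructor termwise
  field
    at : ∀ k → seq x k ≡ seq y k

open _≐_

ℝ-commutativeMonoid : CommutativeMonoid 0ℓ 0ℓ
ℝ-commutativeMonoid = record
  { Carrier = ℝ
  ; _≈_ = _≐_
  ; _∙_ = _+ℝ_
  ; ε = 0ℝ
  ; isCommutativeMonoid = record
    { isMonoid = record
      { isSemigroup = record
        { isMagma = record
          { isEquivalence = record
            { refl  = termwise λ _ → refl
            ; sym   = λ p → termwise λ k → sym (at p k)
            ; trans = λ p q → termwise λ k → trans (at p k) (at q k)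
            }
          ; ∙-cong = λ p q → termwise λ k → cong₂ ℚ._+_ (at p k) (at q k)
          }
        ; assoc = λ x y z → termwise λ k → ℚₚ.+-assoc (seq x k) (seq y k) (seq z k)
        }
      ; identity = (λ x → termwise λ k → ℚₚ.+-identityˡ (seq x k))
                 , (λ x → termwise λ k → ℚₚ.+-identityʳ (seq x k))
      }
    ; comm = λ x y → termwise λ k → ℚₚ.+-comm (seq x k) (seq y k)
    }
  }

½ε>0 : ∀ {ε} → 0ℚ ℚ.< ε → 0ℚ ℚ.< ½ ℚ.* ε
½ε>0 {ε} ε>0 = subst (ℚ._< ½ ℚ.* ε) (ℚₚ.*-zeroʳ ½) (ℚₚ.*-monoʳ-<-pos ½ ε>0)

split-ε : ∀ a b ε → (a ℚ.+ ½ ℚ.* ε) ℚ.+ (b ℚ.+ ½ ℚ.* ε) ≡ (a ℚ.+ b) ℚ.+ ε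
split-ε = solve 3 (λ a b e → (a :+ con ½ :* e) :+ (b :+ con ½ :* e) := (a :+ b) :+ e) refl
  where open +-*-Solver

x<x+ε : ∀ x {ε} → 0ℚ ℚ.< ε → x ℚ.< x ℚ.+ ε
x<x+ε x {ε} ε>0 = subst (ℚ._< x ℚ.+ ε) (ℚₚ.+-identityʳ x) (ℚₚ.+-monoʳ-< x ε>0)

≤ℝ-reflexive : ∀ {x y} → x ≐ y → x ≤ℝ y
≤ℝ-reflexive {x} {y} x≐y ε ε>0 = 0 , λ k _ →
  subst (ℚ._< seq y k ℚ.+ ε) (sym (at x≐y k)) (x<x+ε (seq y k) ε>0)

≤ℝ-trans : ∀ {x y z} → x ≤ℝ y → y ≤ℝ z → x ≤ℝ z
≤ℝ-trans {x} {y} {z} x≤y y≤z ε ε>0 with x≤y (½ ℚ.* ε) (½ε>0 ε>0) | y≤z (½ ℚ.* ε) (½ε>0 ε>0)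
... | K , p | L , q = K ℕ.⊔ L , λ k k≥ → begin-strict
  seq x k
    <⟨ p k (ℕₚ.m⊔n≤o⇒m≤o K L k≥) ⟩
  seq y k ℚ.+ ½ ℚ.* ε
    <⟨ ℚₚ.+-monoˡ-< (½ ℚ.* ε) (q k (ℕₚ.m⊔n≤o⇒n≤o K L k≥)) ⟩
  (seq z k ℚ.+ ½ ℚ.* ε) ℚ.+ ½ ℚ.* ε
    ≡⟨ solve 2 (λ a e → (a :+ con ½ :* e) :+ con ½ :* e := a :+ e) refl (seq z k) ε ⟩
  seq z k ℚ.+ ε ∎
  where
  open ℚₚ.≤-Reasoning
  open +-*-Solver

+ℝ-mono-≤ : ∀ {x y u v} → x ≤ℝ y → u ≤ℝ v → (x +ℝ u) ≤ℝ (y +ℝ v)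
+ℝ-mono-≤ {x} {y} {u} {v} x≤y u≤v ε ε>0
  with x≤y (½ ℚ.* ε) (½ε>0 ε>0) | u≤v (½ ℚ.* ε) (½ε>0 ε>0)
... | K , p | L , q = K ℕ.⊔ L , λ k k≥ →
  subst (seq x k ℚ.+ seq u k ℚ.<_) (split-ε (seq y k) (seq v k) ε)
    (ℚₚ.+-mono-< (p k (ℕₚ.m⊔n≤o⇒m≤o K L k≥)) (q k (ℕₚ.m⊔n≤o⇒n≤o K L k≥)))

-- The terms of `z` cancel exactly at each index, so the same threshold `K` serves.
+ℝ-cancelʳ-≤ : ∀ {x y} z → (x +ℝ z) ≤ℝ (y +ℝ z) → x ≤ℝ y
+ℝ-cancelʳ-≤ {x} {y} z x+z≤y+z ε ε>0 with x+z≤y+z ε ε>0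
... | K , p = K , λ k k≥ → subst₂ ℚ._<_
  (solve 2 (λ a c → (a :+ c) :- c := a) refl (seq x k) (seq z k))
  (solve 3 (λ b c e → ((b :+ c) :+ e) :- c := b :+ e) refl (seq y k) (seq z k) ε)
  (ℚₚ.+-monoˡ-< (ℚ.- seq z k) (p k k≥))
  where open +-*-Solver

-- The two one-sided estimates bound the two possible signs of the difference.
≤ℝ-antisym : ∀ {x y} → x ≤ℝ y → y ≤ℝ x → x ≈ y
≤ℝ-antisym {x} {y} x≤y y≤x ε ε>0 with x≤y ε ε>0 | y≤x ε ε>0
... | K , p | L , q = K ℕ.⊔ L , λ k k≥ →
  close (p k (ℕₚ.m⊔n≤o⇒m≤o K L k≥)) (q k (ℕₚ.m⊔n≤o⇒n≤o K L k≥))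
  where
  open +-*-Solver
  diff< : ∀ {a b} → a ℚ.< b ℚ.+ ε → a ℚ.- b ℚ.< ε
  diff< {a} {b} a<b+ε = subst (a ℚ.- b ℚ.<_)
    (solve 2 (λ b e → (b :+ e) :- b := e) refl b ε) (ℚₚ.+-monoˡ-< (ℚ.- b) a<b+ε)
  close : ∀ {a b} → a ℚ.< b ℚ.+ ε → b ℚ.< a ℚ.+ ε → ℚ.∣ a ℚ.- b ∣ ℚ.< ε
  close {a} {b} a<b+ε b<a+ε with ℚₚ.∣p∣≡p∨∣p∣≡-p (a ℚ.- b)
  ... | inj₁ eq = subst (ℚ._< ε) (sym eq) (diff< a<b+ε)
  ... | inj₂ eq = subst (ℚ._< ε)
    (sym (trans eq (solve 2 (λ a b → :- (a :- b) := b :- a) refl a b))) (diff< b<a+ε)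

p≤∣p∣ : ∀ p → p ℚ.≤ ℚ.∣ p ∣
p≤∣p∣ p with ℚₚ.≤-total 0ℚ p
... | inj₁ 0≤p = ℚₚ.≤-reflexive (sym (ℚₚ.0≤p⇒∣p∣≡p 0≤p))
... | inj₂ p≤0 = ℚₚ.≤-trans p≤0 (ℚₚ.0≤∣p∣ p)

≈⇒≤ℝ : ∀ {x y} → x ≈ y → x ≤ℝ y
≈⇒≤ℝ {x} {y} x≈y ε ε>0 with x≈y ε ε>0
... | K , p = K , λ k k≥ → subst₂ ℚ._<_
  (solve 2 (λ a b → (a :- b) :+ b := a) refl (seq x k) (seq y k)) (ℚₚ.+-comm ε (seq y k))
  (ℚₚ.+-monoˡ-< (seq y k) (ℚₚ.≤-<-trans (p≤∣p∣ (seq x k ℚ.- seq y k)) (p k k≥)))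
  where open +-*-Solver

ℝ-orderedMonoid : OrderedMonoid
ℝ-orderedMonoid = record
  { commutativeMonoid = ℝ-commutativeMonoid
  ; _≼_ = _≤ℝ_
  ; ≼-isPreorder = record
    { isEquivalence = CommutativeMonoid.isEquivalence ℝ-commutativeMonoid
    ; reflexive     = λ {x} {y} → ≤ℝ-reflexive {x} {y}
    ; trans         = λ {x} {y} {z} → ≤ℝ-trans {x} {y} {z}
    }
  ; +-mono    = λ {x} {y} {u} {v} → +ℝ-mono-≤ {x} {y} {u} {v}
  ; +-cancelʳ = λ {x} {y} → +ℝ-cancelʳ-≤ {x} {y}
  }

-- Transfer to weight maps and the least number of vertices

module _ (em : ExcludedMiddle 0ℓ) where

  open Realization em ℝ-orderedMonoid

  realizes⇒minimumCuts : ∀ {n N} (n<N : n < N) (w : WeightMap N) (S : Vector n) →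
                         Realizes n<N w S → MinimumCuts n<N (weight w) S
  realizes⇒minimumCuts n<N w S realizes I I≠∅ =
    let (W , W-separates , W≈S) , S≤ = realizes I I≠∅
    in (W , separates⇒splits n<N W-separates , ≈⇒≤ℝ {∥cut∥ w W} {S I I≠∅} W≈S) ,
       λ V V-splits → S≤ V (splits⇒separates n<N V-splits)

  minimumCuts⇒realizes : ∀ {n N} (n<N : n < N) (w : WeightMap N) (S : Vector n) →
                         MinimumCuts n<N (weight w) S → Realizes n<N w S
  minimumCuts⇒realizes n<N w S min-cuts I I≠∅ =
    let (W , W-splits , W≤S) , S≤ = min-cuts I I≠∅
    in (W , splits⇒separates n<N W-splits ,
        ≤ℝ-antisym {∥cut∥ w W} {S I I≠∅} W≤S (S≤ W W-splits)) ,
       λ V V-separates → S≤ V (separates⇒splits n<N V-separates)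

  allRealizedIn-M : ∀ n → AllRealizedIn n (M n)
  allRealizedIn-M n S (N , n<N , w , realizes) =
    let n<M , w′ , w′≥0 , min-cuts = minimumCuts-compress n<N {weight w} (nonneg w) {S}
                                       (realizes⇒minimumCuts n<N w S realizes)
        merged = record { weight = w′ ; nonneg = w′≥0 }
    in n<M , merged , minimumCuts⇒realizes n<M merged S min-cuts

corollary1 : ExcludedMiddle 0ℓ → (n : ℕ) → 2 ≤ n →
    ∃ λ m → Least (AllRealizedIn n) m × m ≤ M n
corollary1 em n _ = least-exists em (allRealizedIn-M em n)
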